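{- Let $q$ be a prime power, let $n,m$ be positive integers and $k\ge 2$, and let $\mathcal{C}$ be a nondegenerate $[n,k]_{q^m/q}$ code with generalized rank weights $d_1,\dots,d_k$. Then $\mathcal{C}$ is a minimal rank-metric code if and only if $d_2\ge m+1$.
   Context: An $[n,k]_{q^m/q}$ code is a $k$-dimensional $\mathbb{F}_{q^m}$-subspace $\mathcal{C}$ of $\mathbb{F}_{q^m}^n$. For $v=(v_1,\dots,v_n)\in\mathbb{F}_{q^m}^n$, its rank weight is $\mathrm{wt}_{\mathrm{rk}}(v)=\dim_{\mathbb{F}_q}\langle v_1,\dots,v_n\rangle_{\mathbb{F}_q}=r$; choosing an $\mathbb{F}_q$-basis $(u_1,\dots,u_r)$ of $\langle v_1,\dots,v_n\rangle_{\mathbb{F}_q}$, write $v=(u_1,\dots,u_r)A$ with $A\in\mathbb{F}_q^{r\times n}$; the rank support $\mathrm{supp}(v)\subseteq\mathbb{F}_q^n$ is the $\mathbb{F}_q$-row space of $A$ (independent of the choice of basis). A nonzero codeword $v\in\mathcal{C}$ is minimal if for every $u\in\mathcal{C}$: $\mathrm{supp}(u)\subseteq\mathrm{supp}(v)$ iff $u=\lambda v$ for some $\lambda\in\mathbb{F}_{q^m}$; $\mathcal{C}$ is a minimal rank-metric code if every nonzero codeword is minimal. An $\mathbb{F}_{q^m}$-subspace $\mathcal{A}\subseteq\mathbb{F}_{q^m}^n$ is Galois closed if it is mapped to itself by the componentwise $q$-Frobenius map $(a_1,\dots,a_n)\mapsto(a_1^q,\dots,a_n^q)$. For $1\le j\le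 k$, the $j$-th generalized rank weight is $d_j=\min\{\dim_{\mathbb{F}_{q^m}}(\mathcal{A}) : \mathcal{A}\subseteq\mathbb{F}_{q^m}^n \text{ Galois closed } \mathbb{F}_{q^m}\text{ -subspace},\ \dim_{\mathbb{F}_{q^m}}(\mathcal{A}\cap\mathcal{C})\ge j\}$. The code is nondegenerate if $d_k=n$. -}

module Defs where

open import Data.Nat using (ℕ; zero; suc; _≤_; _^_)
open import Data.Nat.Primality using (Prime)
open import Data.Fin using (Fin; zero; suc)
open import Data.Product using (Σ; ∃; _×_; _,_)
open import Data.Unit using (⊤)
open import Relation.Nullary using (¬_)
open import Relation.Binary.PropositionalEquality using (_≡_; _≢_)
open import Function using (_∘_)
open import Function.Bundles using (_↔_; _⇔_)
open import Algebra.Structures using (IsCommutativeRing)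

IsPrimePower : ℕ → Set
IsPrimePower q = Σ ℕ λ p → Σ ℕ λ e → Prime p × 1 ≤ e × q ≡ p ^ e

record FieldStr (L : Set) : Set where
  infixl 6 _+_
  infixl 7 _*_
  field
    _+_ _*_ : L → L → L
    -_      : L → L
    0# 1#   : L
    isCommutativeRing : IsCommutativeRing _≡_ _+_ _*_ -_ 0# 1#
    0≢1     : 0# ≢ 1#
    inverse : ∀ x → x ≢ 0# → Σ L λ y → x * y ≡ 1#

record FiniteField (N : ℕ) : Set₁ where
  field
    L      : Set
    fieldStr : FieldStr L
    card   : Fin N ↔ L
  open FieldStr fieldStr public

-- Linear algebra over L = F_{q^m}, with subfield F_q = {x | x^q = x}

module _ {N : ℕ} (𝔽 : FiniteField N) (q : ℕ) where
  open FiniteField 𝔽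

  ∑ : ∀ {r} → (Fin r → L) → L
  ∑ {zero}  f = 0#
  ∑ {suc r} f = f zero + ∑ (f ∘ suc)

  pow : L → ℕ → L
  pow x zero    = 1#
  pow x (suc e) = x * pow x e

  frob : ∀ {n} → (Fin n → L) → (Fin n → L)
  frob v j = pow (v j) q

  Fq : L → Set
  Fq x = pow x q ≡ x

  All : L → Set
  All _ = ⊤

  InSpan : (S : L → Set) → ∀ {r n} → (Fin r → Fin n → L) → (Fin n → L) → Set
  InSpan S {r} w x = Σ (Fin r → L) λ c → (∀ i → S (c i)) × (∀ j → x j ≡ ∑ (λ i → c i * w i j))

  LinIndep : (S : L → Set) → ∀ {r n} → (Fin r → Fin n → L) → Set
  LinIndep S {r} w = ∀ (c : Fin r → L) → (∀ i → S (c i))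
                     → (∀ j → ∑ (λ i → c i * w i j) ≡ 0#) → ∀ i → c i ≡ 0#

  -- y ∈ supp(v) ⊆ F_q^n : for an F_q-basis (u_1..u_r) of ⟨v_1..v_n⟩_{F_q}
  -- and A ∈ F_q^{r×n} with v = (u_1..u_r) A, y lies in the F_q-row space of A.
  InSupp : ∀ {n} → (v : Fin n → L) → (y : Fin n → L) → Set
  InSupp {n} v y =
    Σ ℕ λ r → Σ (Fin r → L) λ u → Σ (Fin r → Fin n → L) λ A →
      LinIndep Fq {r} {1} (λ i _ → u i)
    × (∀ i → InSpan Fq {n} {1} (λ j _ → v j) (λ _ → u i))
    × (∀ i j → Fq (A i j))
    × (∀ j → v j ≡ ∑ (λ i → u i * A i j))
    × InSpan Fq A y

  SuppSub : ∀ {n} → (Fin n → L) → (Fin n → L) → Set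
  SuppSub u v = ∀ y → InSupp u y → InSupp v y

  -- The code C is the F_{q^m}-row space of a generator matrix G (k×n,
  -- with F_{q^m}-linearly independent rows).
  Codeword : ∀ {k n} → (Fin k → Fin n → L) → (Fin n → L) → Set
  Codeword G v = InSpan All G v

  IsMinimalCodeword : ∀ {k n} → (Fin k → Fin n → L) → (Fin n → L) → Set
  IsMinimalCodeword {k} {n} G v =
    ¬ (∀ j → v j ≡ 0#) ×
    (∀ u → Codeword G u → (SuppSub u v ⇔ (Σ L λ λ' → ∀ j → u j ≡ λ' * v j)))

  IsMinimalCode : ∀ {k n} → (Fin k → Fin n → L) → Set
  IsMinimalCode G = ∀ v → Codeword G v → ¬ (∀ j → v j ≡ 0#) → IsMinimalCodeword G v

  -- A = span_{F_{q^m}}(B), B a basis (so dim A = d), A Galois closed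
  GaloisClosedBasis : ∀ {d n} → (Fin d → Fin n → L) → Set
  GaloisClosedBasis B = LinIndep All B × (∀ x → InSpan All B x → InSpan All B (frob x))

  InterDimAtLeast : ∀ {k d n} → (Fin k → Fin n → L) → (Fin d → Fin n → L) → ℕ → Set
  InterDimAtLeast {n = n} G B j =
    Σ (Fin j → Fin n → L) λ W → LinIndep All W × (∀ i → InSpan All B (W i) × Codeword G (W i))

  IsGenRankWeight : ∀ {k n} → (Fin k → Fin n → L) → ℕ → ℕ → Set
  IsGenRankWeight {k} {n} G j d =
    (Σ (Fin d → Fin n → L) λ B → GaloisClosedBasis B × InterDimAtLeast G B j)
    × (∀ d' (B : Fin d' → Fin n → L) → GaloisClosedBasis B → InterDimAtLeast G B j → d ≤ d')

  Nondegenerate : ∀ {k n} → (Fin k → Fin n → L) → Set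
  Nondegenerate {k} {n} G = IsGenRankWeight G k n

{-# OPTIONS --safe #-}
module Submission where

-- Write φ x = x^q.  Every vector or pair of vectors over L has an F_q-echelon matrix A whose rows span the
-- smallest Galois closed space containing it; for one vector these rows also span its support.  Relations over L
-- that hold on a φ-stable set descend to F_q, so such a space has dimension at most that of any Galois closed
-- space containing the vectors, and at most m for a single vector.
-- If d₂ ≤ m, codewords x, y attaining d₂ have F_q-column rank d ≤ m; as q^d < q^m + 1, some x + β y has rank
-- weight d, hence its support contains that of y although y is not a multiple of it.
-- Conversely, if supp u ⊆ supp v for non-proportional codewords u, v, then both lie in the Galois closed
-- space spanned by supp v, of dimension at most m, so d₂ ≤ m.

open import Defs
open import Data.Nat as ℕ using (ℕ; zero; suc; _≤_; _<_; _^_; z≤n; s≤s; _∸_; _!)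
import Data.Nat.Properties as ℕ
open import Data.Nat.Primality using (Prime; euclidsLemma; prime⇒nonTrivial)
open import Data.Nat.Divisibility using (_∣_; divides; ∣⇒≤; ∣1⇒≡1; m∣m*n)
open import Data.Nat.DivMod using (m/n*n≡m)
open import Data.Nat.Combinatorics using (_C_; nCk≡n!/k![n-k]!; nCn≡1; k![n∸k]!∣n!)
open import Data.Fin as Fin using (Fin; zero; suc; toℕ; fromℕ; inject₁; finToFun; funToFin; combine)
open import Data.Fin.Properties as Fin
  using (any?; all?; pigeonhole; injective⇒≤; finToFun-funToFin; funToFin-finToFin; toℕ-fromℕ; toℕ-inject₁; toℕ<n)
open import Data.Fin.Permutation using (Permutation′; permutation; _⟨$⟩ʳ_)
open import Data.Vec as Vec using (Vec; []; _∷_)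
open import Data.Product using (Σ; ∃; _×_; _,_; proj₁; proj₂)
open import Data.Sum using (inj₁; inj₂)
open import Data.Empty using (⊥)
open import Relation.Nullary using (¬_; Dec; yes; no; contradiction)
open import Relation.Nullary.Decidable using (map′; via-injection; _×-dec_; ¬?; decidable-stable)
open import Relation.Binary.PropositionalEquality
  using (_≡_; _≢_; refl; sym; trans; cong; cong₂; subst; module ≡-Reasoning)
open import Relation.Binary.Definitions using (DecidableEquality)
open import Function using (_∘_; Injective)
open import Function.Bundles using (_⇔_; Inverse; Injection; mk⇔; Equivalence)
open import Function.Properties.Inverse using (↔⇒↣; ↔-sym)
open import Algebra.Bundles using (CommutativeRing; CommutativeMonoid)

-- Prime divisors of binomial coefficients

prime∤! : ∀ {p} → Prime p → ∀ j → j < p → ¬ p ∣ j !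
prime∤! pp zero    j<p p∣ = ℕ.<⇒≢ (ℕ.nonTrivial⇒n>1 _ {{prime⇒nonTrivial pp}}) (sym (∣1⇒≡1 p∣))
prime∤! pp (suc j) j<p p∣ with euclidsLemma (suc j) (j !) pp p∣
... | inj₁ p∣1+j = ℕ.<⇒≱ j<p (∣⇒≤ p∣1+j)
... | inj₂ p∣j!  = prime∤! pp j (ℕ.<-trans (ℕ.n<1+n j) j<p) p∣j!

-- `p !` is the product of `p C k` and `k ! * (p ∸ k) !`, and `p` divides neither factorial because
-- `k` and `p ∸ k` are smaller than `p`.
prime∣binomial : ∀ {p} → Prime p → ∀ {k} → 0 < k → k < p → p ∣ p C k
prime∣binomial {p@(suc p′)} pp {k} 0<k k<p = case
  where
  instance
    nz : ℕ.NonZero (k ! ℕ.* (p ∸ k) !)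
    nz = k ℕ.!* (p ∸ k) !≢0
  split : (p C k) ℕ.* (k ! ℕ.* (p ∸ k) !) ≡ p !
  split = trans (cong (λ c → c ℕ.* (k ! ℕ.* (p ∸ k) !)) (nCk≡n!/k![n-k]! (ℕ.<⇒≤ k<p))) (m/n*n≡m (k![n∸k]!∣n! (ℕ.<⇒≤ k<p)))
  case : p ∣ p C k
  case with euclidsLemma (p C k) (k ! ℕ.* (p ∸ k) !) pp (subst (p ∣_) (sym split) (m∣m*n (p′ !)))
  ... | inj₁ d = d
  ... | inj₂ d with euclidsLemma (k !) ((p ∸ k) !) pp d
  ...   | inj₁ e = contradiction e (prime∤! pp k k<p)
  ...   | inj₂ e = contradiction e (prime∤! pp (p ∸ k) (ℕ.∸-monoʳ-< 0<k (ℕ.<⇒≤ k<p)))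

-- Finite index sets: codes, enumerations, sums

funToFin-cong : ∀ {m n} {f g : Fin m → Fin n} → (∀ i → f i ≡ g i) → funToFin f ≡ funToFin g
funToFin-cong {zero}  f≗g = refl
funToFin-cong {suc m} f≗g = cong₂ combine (f≗g zero) (funToFin-cong (f≗g ∘ suc))

-- Applied to F_q inside `L`: the injective list `elem` bounds the number of elements, and `index`
-- turns vectors over F_q into codes for the pigeonhole principle.
record Enumeration {N} (P : Fin N → Set) : Set where
  field
    size      : ℕ
    elem      : Fin size → Fin N
    elem-inj  : ∀ {i j} → elem i ≡ elem j → i ≡ j
    sound     : ∀ i → P (elem i)
    index     : ∀ x → P x → Fin size
    elem-index : ∀ x Px → elem (index x Px) ≡ x

enumerate : ∀ {N} {P : Fin N → Set} → (∀ x → Dec (P x)) → Enumeration P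
enumerate {zero} P? = record
  { size = 0 ; elem = λ () ; elem-inj = λ { {()} } ; sound = λ () ; index = λ () ; elem-index = λ () }
enumerate {suc N} {P} P? with P? zero | enumerate (P? ∘ suc)
... | yes P0 | E = record
  { size = suc size
  ; elem = λ { zero → zero ; (suc i) → suc (elem i) }
  ; elem-inj = λ { {zero} {zero} _ → refl ; {suc i} {suc j} eq → cong suc (elem-inj (Fin.suc-injective eq)) }
  ; sound = λ { zero → P0 ; (suc i) → sound i }
  ; index = λ { zero _ → zero ; (suc x) Px → suc (index x Px) }
  ; elem-index = λ { zero _ → refl ; (suc x) Px → cong suc (elem-index x Px) } }
  where open Enumeration E
... | no ¬P0 | E = record
  { size = size
  ; elem = suc ∘ elem
  ; elem-inj = elem-inj ∘ Fin.suc-injective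
  ; sound = sound
  ; index = λ { zero P0 → contradiction P0 ¬P0 ; (suc x) Px → index x Px }
  ; elem-index = λ { zero P0 → contradiction P0 ¬P0 ; (suc x) Px → cong suc (elem-index x Px) } }
  where open Enumeration E

module _ {c ℓ} (M : CommutativeMonoid c ℓ) where
  open CommutativeMonoid M using (Carrier; _≈_; _∙_; ε; ∙-congˡ; identityʳ) renaming (trans to ≈-trans)
  open import Algebra.Properties.CommutativeMonoid.Sum M using (sum; sum-remove; sum-cong-≋; sum-replicate-zero)
  open import Relation.Binary.Reasoning.Setoid (CommutativeMonoid.setoid M)

  -- Kept in monoid generality because it is applied multiplicatively, to a product whose factors
  -- are 1 away from one index.
  sum-single : ∀ {n} (t : Fin n → Carrier) i → (∀ j → j ≢ i → t j ≈ ε) → sum t ≈ t i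
  sum-single {suc n} t i t≈ε = begin
    sum t                              ≈⟨ sum-remove {i = i} t ⟩
    t i ∙ sum (t ∘ Fin.punchIn i)      ≈⟨ ∙-congˡ (≈-trans
      (sum-cong-≋ (λ j → t≈ε (Fin.punchIn i j) (Fin.punchInᵢ≢i i j))) (sum-replicate-zero n)) ⟩
    t i ∙ ε                            ≈⟨ identityʳ (t i) ⟩
    t i                                ∎

-- Finite fields: cancellation and exhaustive search

module Field {N : ℕ} (𝔽 : FiniteField N) (q : ℕ) where
  open FiniteField 𝔽

  commutativeRing : CommutativeRing _ _
  commutativeRing = record { isCommutativeRing = isCommutativeRing }

  open CommutativeRing commutativeRing public
    using (_-_; ring; +-group; semiring; commutativeSemiring; *-commutativeMonoid
          ; +-assoc; +-comm; +-identityˡ; +-identityʳ; -‿inverseˡ; -‿inverseʳ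
          ; *-assoc; *-comm; *-identityˡ; *-identityʳ; distribˡ; distribʳ; zeroˡ; zeroʳ)
  open import Algebra.Properties.Group +-group public using ()
    renaming (x∙y⁻¹≈ε⇒x≈y to x-y≡0⇒x≡y; x≈y⇒x∙y⁻¹≈ε to x≡y⇒x-y≡0; inverseˡ-unique to +-inverseˡ-unique; ∙-cancelˡ to +-cancelˡ)
  open import Algebra.Properties.Group +-group using (loop)
  open import Algebra.Properties.Loop loop public
    using () renaming (identityʳ-unique to +-identityʳ-unique)
  open import Algebra.Properties.Ring ring public
    using (-‿distribˡ-*; -‿distribʳ-*; [y-z]x≈yx-zx; -0#≈0#; -‿+-comm)
  import Algebra.Properties.Semiring.Sum semiring as Sum
  import Algebra.Properties.CommutativeMonoid.Sum *-commutativeMonoid as Product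
  open import Algebra.Properties.Semiring.Mult semiring public using (×-assoc-*; ×1-homo-*; ×-assocˡ)
    renaming (_×_ to _·_)
  open import Algebra.Properties.Semiring.Exp semiring using (^-assocʳ) renaming (_^_ to _^ᴸ_)
  open import Algebra.Properties.CommutativeSemiring.Exp commutativeSemiring using (^-distrib-*)
  open import Algebra.Properties.CommutativeSemiring.Binomial commutativeSemiring
    using (binomialTerm) renaming (theorem to binomial-theorem)
  open import Algebra.Solver.Ring.NaturalCoefficients.Default commutativeSemiring
    using (solve; _:=_; _:+_; _:*_)

  open ≡-Reasoning

  private
    ∑′ : ∀ {r} → (Fin r → L) → L
    ∑′ = ∑ 𝔽 q

  x*y≡0⇒y≡0 : ∀ {x y} → x ≢ 0# → x * y ≡ 0# → y ≡ 0#
  x*y≡0⇒y≡0 {x} {y} x≢0 xy≡0 with inverse x x≢0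
  ... | x⁻¹ , xx⁻¹≡1 = begin
    y             ≡⟨ *-identityˡ y ⟨
    1# * y        ≡⟨ cong (_* y) (trans (*-comm x⁻¹ x) xx⁻¹≡1) ⟨
    x⁻¹ * x * y   ≡⟨ *-assoc x⁻¹ x y ⟩
    x⁻¹ * (x * y) ≡⟨ cong (x⁻¹ *_) xy≡0 ⟩
    x⁻¹ * 0#      ≡⟨ zeroʳ x⁻¹ ⟩
    0#            ∎

  *-cancelʳ : ∀ {x y z} → z ≢ 0# → x * z ≡ y * z → x ≡ y
  *-cancelʳ {x} {y} {z} z≢0 eq = x-y≡0⇒x≡y x y (x*y≡0⇒y≡0 z≢0 (trans (*-comm z _)
    (trans ([y-z]x≈yx-zx z x y) (x≡y⇒x-y≡0 eq))))

  x+[y-x]≡y : ∀ x y → x + (y - x) ≡ y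
  x+[y-x]≡y x y = begin
    x + (y - x)     ≡⟨ +-comm x _ ⟩
    (y - x) + x     ≡⟨ +-assoc y (- x) x ⟩
    y + (- x + x)   ≡⟨ cong (y +_) (-‿inverseˡ x) ⟩
    y + 0#          ≡⟨ +-identityʳ y ⟩
    y               ∎

  open Inverse card public using () renaming (to to fromIndex; from to toIndex)

  fromIndex∘toIndex : ∀ x → fromIndex (toIndex x) ≡ x
  fromIndex∘toIndex = Inverse.strictlyInverseˡ card

  toIndex-injective : ∀ {x y} → toIndex x ≡ toIndex y → x ≡ y
  toIndex-injective {x} {y} eq = trans (sym (fromIndex∘toIndex x)) (trans (cong fromIndex eq) (fromIndex∘toIndex y))

  infix 4 _≟_
  _≟_ : DecidableEquality L
  _≟_ = via-injection (↔⇒↣ (↔-sym card)) Fin._≟_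

  any-scalar? : {P : L → Set} → (∀ x → Dec (P x)) → Dec (∃ P)
  any-scalar? {P} P? = map′ (λ { (i , p) → fromIndex i , p })
    (λ { (x , p) → toIndex x , subst P (sym (fromIndex∘toIndex x)) p }) (any? (P? ∘ fromIndex))

  encode : ∀ {d} → (Fin d → L) → Fin (N ^ d)
  encode f = funToFin (toIndex ∘ f)

  decode : ∀ {d} → Fin (N ^ d) → Fin d → L
  decode k = fromIndex ∘ finToFun k

  decode-encode : ∀ {d} (f : Fin d → L) j → decode (encode f) j ≡ f j
  decode-encode f j = trans (cong fromIndex (finToFun-funToFin (toIndex ∘ f) j)) (fromIndex∘toIndex (f j))

  encode-cong⁻¹ : ∀ {d} {f g : Fin d → L} → encode f ≡ encode g → ∀ j → f j ≡ g j
  encode-cong⁻¹ {f = f} {g} eq j =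
    trans (sym (decode-encode f j)) (trans (cong (λ k → decode k j) eq) (decode-encode g j))

  decode-cong⁻¹ : ∀ {d} {k l : Fin (N ^ d)} → (∀ j → decode {d} k j ≡ decode l j) → k ≡ l
  decode-cong⁻¹ {d} {k} {l} eq = begin
    k                                ≡⟨ funToFin-finToFin {d} k ⟨
    funToFin (finToFun {N} {d} k)    ≡⟨ funToFin-cong (λ j → Injection.injective (↔⇒↣ card) (eq j)) ⟩
    funToFin (finToFun {N} {d} l)    ≡⟨ funToFin-finToFin {d} l ⟩
    l                                ∎

  -- The search runs over the `N ^ d` codes; `resp` is required because decoding recovers a vector
  -- only up to pointwise equality.
  any-vector? : ∀ {d} {P : (Fin d → L) → Set} → (∀ {f g} → (∀ j → f j ≡ g j) → P f → P g) →
                (∀ f → Dec (P f)) → Dec (∃ P)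
  any-vector? resp P? = map′ (λ { (k , p) → decode k , p })
    (λ { (f , p) → encode f , resp (λ j → sym (decode-encode f j)) p }) (any? (P? ∘ decode))

  1<N : 1 < N
  1<N = injective⇒≤ {f = f} f-injective
    where
    f : Fin 2 → Fin N
    f zero    = toIndex 0#
    f (suc _) = toIndex 1#
    f-injective : Injective _≡_ _≡_ f
    f-injective {zero}     {zero}     _  = refl
    f-injective {zero}     {suc zero} eq = contradiction (toIndex-injective eq) 0≢1
    f-injective {suc zero} {zero}     eq = contradiction (toIndex-injective (sym eq)) 0≢1
    f-injective {suc zero} {suc zero} _  = refl

  -- Finite sums in the field

  ∑≡sum : ∀ {r} (f : Fin r → L) → ∑′ f ≡ Sum.sum f
  ∑≡sum {zero}  f = refl
  ∑≡sum {suc r} f = cong (f zero +_) (∑≡sum (f ∘ suc))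

  ∑-cong : ∀ {r} {f g : Fin r → L} → (∀ i → f i ≡ g i) → ∑′ f ≡ ∑′ g
  ∑-cong {zero}  f≗g = refl
  ∑-cong {suc r} f≗g = cong₂ _+_ (f≗g zero) (∑-cong (f≗g ∘ suc))

  ∑-zero : ∀ {r} {f : Fin r → L} → (∀ i → f i ≡ 0#) → ∑′ f ≡ 0#
  ∑-zero {zero}  f≗0 = refl
  ∑-zero {suc r} f≗0 = trans (cong₂ _+_ (f≗0 zero) (∑-zero (f≗0 ∘ suc))) (+-identityˡ 0#)

  ∑-+ : ∀ {r} (f g : Fin r → L) → ∑′ (λ i → f i + g i) ≡ ∑′ f + ∑′ g
  ∑-+ f g = trans (∑≡sum (λ i → f i + g i)) (trans (Sum.∑-distrib-+ f g) (sym (cong₂ _+_ (∑≡sum f) (∑≡sum g))))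

  *-∑ : ∀ {r} x (f : Fin r → L) → x * ∑′ f ≡ ∑′ (λ i → x * f i)
  *-∑ x f = trans (cong (x *_) (∑≡sum f)) (trans (Sum.*-distribˡ-sum x f) (sym (∑≡sum (λ i → x * f i))))

  ∑-* : ∀ {r} x (f : Fin r → L) → ∑′ f * x ≡ ∑′ (λ i → f i * x)
  ∑-* x f = trans (cong (_* x) (∑≡sum f)) (trans (Sum.*-distribʳ-sum x f) (sym (∑≡sum (λ i → f i * x))))

  ∑-swap : ∀ {r s} (f : Fin r → Fin s → L) → ∑′ (λ i → ∑′ (f i)) ≡ ∑′ (λ j → ∑′ (λ i → f i j))
  ∑-swap f = trans (∑∑≡sum f) (trans (Sum.∑-comm f) (sym (∑∑≡sum (λ j i → f i j))))
    where
    ∑∑≡sum : ∀ {r s} (f : Fin r → Fin s → L) → ∑′ (λ i → ∑′ (f i)) ≡ Sum.sum (λ i → Sum.sum (f i))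
    ∑∑≡sum f = trans (∑-cong (λ i → ∑≡sum (f i))) (∑≡sum (λ i → Sum.sum (f i)))

  ∑-hom : (h : L → L) → h 0# ≡ 0# → (∀ x y → h (x + y) ≡ h x + h y) →
          ∀ {r} (f : Fin r → L) → h (∑′ f) ≡ ∑′ (h ∘ f)
  ∑-hom h h0 h+ {zero}  f = h0
  ∑-hom h h0 h+ {suc r} f = trans (h+ _ _) (cong (h (f zero) +_) (∑-hom h h0 h+ (f ∘ suc)))

  -- Roots of monic polynomials and the size of F_q

  -- Horner form; the vector lists the coefficients below the leading 1, constant term first.
  monic : ∀ {n} → Vec L n → L → L
  monic []       x = 1#
  monic (c ∷ cs) x = c + x * monic cs x

  -- Synthetic division by `x - a`: the coefficients of the quotient are the values at `a` of the
  -- successive Horner tails.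
  monic-factor : ∀ {n} (cs : Vec L (suc n)) a →
                 ∃ λ (ds : Vec L n) → ∀ x → monic cs x ≡ monic cs a + (x - a) * monic ds x
  monic-factor (c ∷ []) a = [] , λ x → begin
    c + x * 1#                  ≡⟨ cong (λ z → c + z * 1#) (x+[y-x]≡y a x) ⟨
    c + (a + (x - a)) * 1#      ≡⟨ solve 4 (λ c a t o → c :+ (a :+ t) :* o := (c :+ a :* o) :+ t :* o) refl c a (x - a) 1# ⟩
    (c + a * 1#) + (x - a) * 1# ∎
  monic-factor (c ∷ cs@(_ ∷ _)) a with monic-factor cs a
  ... | ds , eq = monic cs a ∷ ds , λ x → let g = monic cs a; h = monic ds x; t = x - a in begin
    c + x * monic cs x                ≡⟨ cong (λ z → c + x * z) (eq x) ⟩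
    c + x * (g + t * h)               ≡⟨ solve 5 (λ c x g t h → c :+ x :* (g :+ t :* h) := c :+ (x :* g :+ t :* (x :* h))) refl c x g t h ⟩
    c + (x * g + t * (x * h))         ≡⟨ cong (λ z → c + (z * g + t * (x * h))) (x+[y-x]≡y a x) ⟨
    c + ((a + t) * g + t * (x * h))   ≡⟨ solve 5 (λ c a g t k → c :+ ((a :+ t) :* g :+ t :* k) := (c :+ a :* g) :+ t :* (g :+ k)) refl c a g t (x * h) ⟩
    (c + a * g) + t * (g + x * h)     ∎

  -- Dividing off the first root leaves a monic quotient of lower degree that vanishes at all the
  -- other roots; in degree 0 the polynomial is 1.
  monic-root-bound : ∀ {n} (cs : Vec L n) (r : Fin (suc n) → L) → Injective _≡_ _≡_ r →
                     ¬ (∀ i → monic cs (r i) ≡ 0#)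
  monic-root-bound [] r r-inj roots = 0≢1 (sym (roots zero))
  monic-root-bound cs@(_ ∷ _) r r-inj roots with monic-factor cs (r zero)
  ... | ds , eq = monic-root-bound ds (r ∘ suc) (Fin.suc-injective ∘ r-inj) λ i →
    x*y≡0⇒y≡0 (λ r≡ → Fin.0≢1+n (sym (r-inj (x-y≡0⇒x≡y _ _ r≡)))) (begin
      (r (suc i) - r zero) * monic ds (r (suc i))                          ≡⟨ +-identityˡ _ ⟨
      0# + (r (suc i) - r zero) * monic ds (r (suc i))                     ≡⟨ cong (_+ ((r (suc i) - r zero) * monic ds (r (suc i)))) (roots zero) ⟨
      monic cs (r zero) + (r (suc i) - r zero) * monic ds (r (suc i))      ≡⟨ eq (r (suc i)) ⟨
      monic cs (r (suc i))                                                 ≡⟨ roots (suc i) ⟩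
      0#                                                                   ∎)

  pow≡^ : ∀ x e → pow 𝔽 q x e ≡ x ^ᴸ e
  pow≡^ x zero    = refl
  pow≡^ x (suc e) = cong (x *_) (pow≡^ x e)

  monic-power : ∀ n x → monic (Vec.replicate n 0#) x ≡ pow 𝔽 q x n
  monic-power zero    x = refl
  monic-power (suc n) x = trans (+-identityˡ _) (cong (x *_) (monic-power n x))

  -- F_q consists of the roots of `x^q - x`, which is monic of degree `q` because `1 < q` keeps the
  -- linear term apart from the leading one.
  Fq-size : 1 < q → ∀ {s} (e : Fin s → L) → Injective _≡_ _≡_ e → (∀ i → Fq 𝔽 q (e i)) → s ≤ q
  Fq-size (s≤s (s≤s {n = q′} _)) {s} e e-inj e∈Fq = ℕ.≮⇒≥ λ q<s →
    monic-root-bound cs (e ∘ λ i → Fin.inject≤ i q<s) (Fin.inject≤-injective q<s q<s _ _ ∘ e-inj)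
      λ i → root (e (Fin.inject≤ i q<s)) (e∈Fq _)
    where
    cs : Vec L q
    -- With `q = q′ + 2`: constant term 0, linear coefficient -1, then `q′` zeros below the leading
    -- 1.
    cs = 0# ∷ - 1# ∷ Vec.replicate q′ 0#
    root : ∀ x → Fq 𝔽 q x → monic cs x ≡ 0#
    root x x^q≡x = begin
      0# + x * (- 1# + x * monic (Vec.replicate q′ 0#) x)  ≡⟨ +-identityˡ _ ⟩
      x * (- 1# + x * monic (Vec.replicate q′ 0#) x)       ≡⟨ cong (λ z → x * (- 1# + x * z)) (monic-power q′ x) ⟩
      x * (- 1# + x * pow 𝔽 q x q′)                        ≡⟨ distribˡ x _ _ ⟩
      x * - 1# + pow 𝔽 q x q                               ≡⟨ cong₂ _+_ (trans (sym (-‿distribʳ-* x 1#)) (cong -_ (*-identityʳ x))) x^q≡x ⟩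
      - x + x                                              ≡⟨ -‿inverseˡ x ⟩
      0#                                                   ∎

  -- Sums and products over the whole field

  permute : (f f⁻¹ : L → L) → (∀ x → f (f⁻¹ x) ≡ x) → (∀ x → f⁻¹ (f x) ≡ x) → Permutation′ N
  permute f f⁻¹ ff⁻¹ f⁻¹f = permutation (conj f) (conj f⁻¹) (conj-inverse f f⁻¹ ff⁻¹) (conj-inverse f⁻¹ f f⁻¹f)
    where
    conj : (L → L) → Fin N → Fin N
    conj g = toIndex ∘ g ∘ fromIndex
    conj-inverse : ∀ g h → (∀ x → g (h x) ≡ x) → ∀ i → conj g (conj h i) ≡ i
    conj-inverse g h gh i = begin
      toIndex (g (fromIndex (toIndex (h (fromIndex i))))) ≡⟨ cong (toIndex ∘ g) (fromIndex∘toIndex _) ⟩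
      toIndex (g (h (fromIndex i)))                       ≡⟨ cong toIndex (gh _) ⟩
      toIndex (fromIndex i)                               ≡⟨ Inverse.strictlyInverseʳ card i ⟩
      i                                                   ∎

  -- Translation by 1 permutes `L`, so the sum `S` of all elements equals `S + N · 1#`.
  N·1≡0 : N · 1# ≡ 0#
  N·1≡0 = +-identityʳ-unique S (N · 1#) (sym (begin
    S                                          ≡⟨ Sum.sum-permute fromIndex π ⟩
    Sum.sum (λ i → fromIndex (π ⟨$⟩ʳ i))       ≡⟨ Sum.sum-cong-≗ (λ i → fromIndex∘toIndex (fromIndex i + 1#)) ⟩
    Sum.sum (λ i → fromIndex i + 1#)           ≡⟨ Sum.∑-distrib-+ fromIndex (λ _ → 1#) ⟩
    S + Sum.sum {N} (λ _ → 1#)                 ≡⟨ cong (S +_) (Sum.sum-replicate N) ⟩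
    S + N · 1#                                 ∎))
    where
    S : L
    S = Sum.sum fromIndex
    π : Permutation′ N
    π = permute (_+ 1#) (_- 1#)
      (λ x → trans (+-assoc x _ _) (trans (cong (x +_) (-‿inverseˡ 1#)) (+-identityʳ x)))
      (λ x → trans (+-assoc x _ _) (trans (cong (x +_) (-‿inverseʳ 1#)) (+-identityʳ x)))

  product-nonzero : ∀ {n} (t : Fin n → L) → (∀ i → t i ≢ 0#) → Product.sum t ≢ 0#
  product-nonzero {zero}  t t≢0 Πt≡0 = 0≢1 (sym Πt≡0)
  product-nonzero {suc n} t t≢0 Πt≡0 =
    product-nonzero (t ∘ suc) (t≢0 ∘ suc) (x*y≡0⇒y≡0 (t≢0 zero) Πt≡0)

  caseZero : L → L → L → L
  caseZero a b y with y ≟ 0#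
  ... | yes _ = a
  ... | no  _ = b

  caseZero-≢ : ∀ a b {y} → y ≢ 0# → caseZero a b y ≡ b
  caseZero-≢ a b {y} y≢0 with y ≟ 0#
  ... | yes y≡0 = contradiction y≡0 y≢0
  ... | no  _   = refl

  caseZero-≡ : ∀ a b {y} → y ≡ 0# → caseZero a b y ≡ a
  caseZero-≡ a b {y} y≡0 with y ≟ 0#
  ... | yes _   = refl
  ... | no  y≢0 = contradiction y≡0 y≢0

  -- For x ≢ 0 the permutation y ↦ x y preserves the product of the nonzero elements.  Products run over
  -- all of L: in f the element 0 is replaced by 1, and h puts back the factor x that g lacks at 0.
  x^N≡x : ∀ x → x ^ᴸ N ≡ x
  x^N≡x x with x ≟ 0#
  ... | yes refl = lemma 1<N
    where
    lemma : ∀ {n} → 1 < n → 0# ^ᴸ n ≡ 0#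
    lemma (s≤s _) = zeroˡ _
  ... | no x≢0 with inverse x x≢0
  ...   | x⁻¹ , xx⁻¹≡1 = begin
    x ^ᴸ N                                             ≡⟨ Product.sum-replicate N ⟨
    Π (λ _ → x)                                        ≡⟨ Product.sum-cong-≗ {N} (λ i → sym (g*h (fromIndex i))) ⟩
    Π (λ y → g y * h y)                                ≡⟨ Product.∑-distrib-+ (g ∘ fromIndex) (h ∘ fromIndex) ⟩
    Π g * Π h                                          ≡⟨ cong₂ _*_ Πg≡1 Πh≡x ⟩
    1# * x                                             ≡⟨ *-identityˡ x ⟩
    x                                                  ∎
    where
    f g h : L → L
    f y = caseZero 1# y y
    g y = caseZero 1# x y
    h y = caseZero x 1# y
    Π : (L → L) → L
    Π k = Product.sum (k ∘ fromIndex)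
    g*h : ∀ y → g y * h y ≡ x
    g*h y with y ≟ 0#
    ... | yes _ = *-identityˡ x
    ... | no  _ = *-identityʳ x
    f[x*y] : ∀ y → f (x * y) ≡ g y * f y
    f[x*y] y with y ≟ 0#
    ... | yes refl = trans (caseZero-≡ 1# _ (zeroʳ x)) (sym (*-identityˡ 1#))
    ... | no  y≢0  = caseZero-≢ 1# _ (y≢0 ∘ x*y≡0⇒y≡0 x≢0)
    x⁻¹x≡1 : x⁻¹ * x ≡ 1#
    x⁻¹x≡1 = trans (*-comm x⁻¹ x) xx⁻¹≡1
    π : Permutation′ N
    π = permute (x *_) (x⁻¹ *_)
      (λ y → trans (sym (*-assoc x x⁻¹ y)) (trans (cong (_* y) xx⁻¹≡1) (*-identityˡ y)))
      (λ y → trans (sym (*-assoc x⁻¹ x y)) (trans (cong (_* y) x⁻¹x≡1) (*-identityˡ y)))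
    Πf≢0 : Π f ≢ 0#
    Πf≢0 = product-nonzero (f ∘ fromIndex) (λ i → f≢0 (fromIndex i))
      where
      f≢0 : ∀ y → f y ≢ 0#
      f≢0 y with y ≟ 0#
      ... | yes _   = 0≢1 ∘ sym
      ... | no  y≢0 = y≢0
    Πg≡1 : Π g ≡ 1#
    Πg≡1 = *-cancelʳ Πf≢0 (begin
      Π g * Π f                                         ≡⟨ Product.∑-distrib-+ (g ∘ fromIndex) (f ∘ fromIndex) ⟨
      Π (λ y → g y * f y)                               ≡⟨ Product.sum-cong-≗ {N} (λ i → sym (f[x*y] (fromIndex i))) ⟩
      Π (λ y → f (x * y))                               ≡⟨ Product.sum-cong-≗ {N} (λ i → cong f (sym (fromIndex∘toIndex (x * fromIndex i)))) ⟩
      Product.sum (λ i → f (fromIndex (π ⟨$⟩ʳ i)))      ≡⟨ Product.sum-permute (f ∘ fromIndex) π ⟨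
      Π f                                               ≡⟨ *-identityˡ _ ⟨
      1# * Π f                                          ∎)
    Πh≡x : Π h ≡ x
    Πh≡x = trans
      (sum-single *-commutativeMonoid (h ∘ fromIndex) (toIndex 0#) λ j j≢ → caseZero-≢ x 1#
        (λ j≡0 → j≢ (trans (sym (Inverse.strictlyInverseʳ card j)) (cong toIndex j≡0))))
      (caseZero-≡ x 1# (fromIndex∘toIndex 0#))

  -- Characteristic and additivity of Frobenius

  -- Without zero divisors, a nonzero factor `p · 1#` could be cancelled repeatedly, down to
  -- `1# ≡ 0#`.
  p^k·1≡0⇒p·1≡0 : ∀ p k → (p ^ k) · 1# ≡ 0# → p · 1# ≡ 0#
  p^k·1≡0⇒p·1≡0 p zero    eq = contradiction (sym (trans (sym (+-identityʳ 1#)) eq)) 0≢1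
  p^k·1≡0⇒p·1≡0 p (suc k) eq with p · 1# ≟ 0#
  ... | yes p·1≡0 = p·1≡0
  ... | no  p·1≢0 = p^k·1≡0⇒p·1≡0 p k (x*y≡0⇒y≡0 p·1≢0 (trans (sym (×1-homo-* p (p ^ k))) eq))

  -- All inner terms of the binomial expansion vanish, their coefficients being multiples of `p`.
  [x+y]^p : ∀ {p} → Prime p → p · 1# ≡ 0# → ∀ x y → (x + y) ^ᴸ p ≡ x ^ᴸ p + y ^ᴸ p
  [x+y]^p {p@(suc p′)} pp p·1≡0 x y = begin
    (x + y) ^ᴸ p                                              ≡⟨ binomial-theorem p x y ⟩
    t zero + Sum.sum (t ∘ suc)                                ≡⟨ cong (t zero +_) (Sum.sum-init-last (t ∘ suc)) ⟩
    t zero + (Sum.sum (t ∘ suc ∘ inject₁) + t (suc (fromℕ p′))) ≡⟨ cong₂ (λ a b → a + (b + t (suc (fromℕ p′)))) t-first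
                                                                    (trans (Sum.sum-cong-≗ t-middle) (Sum.sum-replicate-zero p′)) ⟩
    y ^ᴸ p + (0# + t (suc (fromℕ p′)))                        ≡⟨ cong (y ^ᴸ p +_) (+-identityˡ _) ⟩
    y ^ᴸ p + t (suc (fromℕ p′))                               ≡⟨ cong (y ^ᴸ p +_) t-last ⟩
    y ^ᴸ p + x ^ᴸ p                                           ≡⟨ +-comm _ _ ⟩
    x ^ᴸ p + y ^ᴸ p                                           ∎
    where
    t : Fin (suc p) → L
    t = binomialTerm x y p
    t-first : t zero ≡ y ^ᴸ p
    t-first = trans (+-identityʳ _) (*-identityˡ _)
    t-last : t (suc (fromℕ p′)) ≡ x ^ᴸ p
    t-last rewrite toℕ-fromℕ p′ | nCn≡1 p | ℕ.n∸n≡0 p′ = trans (+-identityʳ _) (*-identityʳ _)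
    p·z≡0 : ∀ z → p · z ≡ 0#
    p·z≡0 z = begin
      p · z           ≡⟨ cong (p ·_) (*-identityˡ z) ⟨
      p · (1# * z)    ≡⟨ ×-assoc-* p 1# z ⟨
      (p · 1#) * z    ≡⟨ cong (_* z) p·1≡0 ⟩
      0# * z          ≡⟨ zeroˡ z ⟩
      0#              ∎
    multiple : ∀ {c} z → p ∣ c → c · z ≡ 0#
    multiple z (divides j refl) = begin
      (j ℕ.* p) · z   ≡⟨ cong (_· z) (ℕ.*-comm j p) ⟩
      (p ℕ.* j) · z   ≡⟨ ×-assocˡ z p j ⟨
      p · (j · z)     ≡⟨ p·z≡0 (j · z) ⟩
      0#              ∎
    t-middle : ∀ i → t (suc (inject₁ i)) ≡ 0#
    t-middle i = multiple _ (prime∣binomial pp (s≤s z≤n)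
      (s≤s (subst (_< p′) (sym (toℕ-inject₁ i)) (toℕ<n i))))

  [x+y]^p^e : ∀ {p} → Prime p → p · 1# ≡ 0# → ∀ e x y → (x + y) ^ᴸ (p ^ e) ≡ x ^ᴸ (p ^ e) + y ^ᴸ (p ^ e)
  [x+y]^p^e pp p·1≡0 zero x y = trans (*-identityʳ _) (sym (cong₂ _+_ (*-identityʳ x) (*-identityʳ y)))
  [x+y]^p^e {p} pp p·1≡0 (suc e) x y = begin
    (x + y) ^ᴸ (p ^ suc e)                   ≡⟨ ^-assocʳ (x + y) p (p ^ e) ⟨
    ((x + y) ^ᴸ p) ^ᴸ (p ^ e)                ≡⟨ cong (_^ᴸ (p ^ e)) ([x+y]^p pp p·1≡0 x y) ⟩
    (x ^ᴸ p + y ^ᴸ p) ^ᴸ (p ^ e)             ≡⟨ [x+y]^p^e pp p·1≡0 e _ _ ⟩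
    (x ^ᴸ p) ^ᴸ (p ^ e) + (y ^ᴸ p) ^ᴸ (p ^ e) ≡⟨ cong₂ _+_ (^-assocʳ x p (p ^ e)) (^-assocʳ y p (p ^ e)) ⟩
    x ^ᴸ (p ^ suc e) + y ^ᴸ (p ^ suc e)      ∎

  pow-* : ∀ e x y → pow 𝔽 q (x * y) e ≡ pow 𝔽 q x e * pow 𝔽 q y e
  pow-* e x y = trans (pow≡^ (x * y) e) (trans (^-distrib-* x y e) (sym (cong₂ _*_ (pow≡^ x e) (pow≡^ y e))))

  pow-1 : ∀ e → pow 𝔽 q 1# e ≡ 1#
  pow-1 zero    = refl
  pow-1 (suc e) = trans (*-identityˡ _) (pow-1 e)

  pow-pow : ∀ x a b → pow 𝔽 q (pow 𝔽 q x a) b ≡ pow 𝔽 q x (a ℕ.* b)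
  pow-pow x a b = trans (pow≡^ _ b) (trans (cong (_^ᴸ b) (pow≡^ x a)) (trans (^-assocʳ x a b) (sym (pow≡^ x (a ℕ.* b)))))

  pow-N : ∀ x → pow 𝔽 q x N ≡ x
  pow-N x = trans (pow≡^ x N) (x^N≡x x)

  -- Linear combinations and independence

  infix 8 _∙_
  -- Entry `j` of a combination of the rows of `w` is `c ∙ (λ i → w i j)`, the form occurring in
  -- both `InSpan` and `LinIndep`.
  _∙_ : ∀ {r} → (Fin r → L) → (Fin r → L) → L
  c ∙ w = ∑′ (λ i → c i * w i)

  ∙-cong : ∀ {r} {c c′ w w′ : Fin r → L} → (∀ i → c i ≡ c′ i) → (∀ i → w i ≡ w′ i) → c ∙ w ≡ c′ ∙ w′
  ∙-cong c≗c′ w≗w′ = ∑-cong (λ i → cong₂ _*_ (c≗c′ i) (w≗w′ i))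

  ∙-comm : ∀ {r} (c w : Fin r → L) → c ∙ w ≡ w ∙ c
  ∙-comm c w = ∑-cong (λ i → *-comm (c i) (w i))

  ∙-+ : ∀ {r} (c c′ w : Fin r → L) → (λ i → c i + c′ i) ∙ w ≡ c ∙ w + c′ ∙ w
  ∙-+ c c′ w = trans (∑-cong (λ i → distribʳ (w i) (c i) (c′ i))) (∑-+ (λ i → c i * w i) (λ i → c′ i * w i))

  *-∙ : ∀ {r} x (c w : Fin r → L) → x * c ∙ w ≡ (λ i → x * c i) ∙ w
  *-∙ x c w = trans (*-∑ x (λ i → c i * w i)) (∑-cong (λ i → sym (*-assoc x (c i) (w i))))

  ∙-− : ∀ {r} (c c′ w : Fin r → L) → (λ i → c i - c′ i) ∙ w ≡ c ∙ w - c′ ∙ w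
  ∙-− c c′ w = trans (∙-+ c (λ i → - c′ i) w) (cong (c ∙ w +_) (trans
    (∑-cong (λ i → sym (-‿distribˡ-* (c′ i) (w i))))
    (sym (∑-hom -_ -0#≈0# (λ x y → sym (-‿+-comm x y)) (λ i → c′ i * w i)))))

  -- Matrix associativity `c (A w) = (c A) w`, by exchanging the two summations.
  ∙-assoc : ∀ {r s} (c : Fin r → L) (A : Fin r → Fin s → L) (w : Fin s → L) →
            c ∙ (λ i → A i ∙ w) ≡ (λ l → c ∙ (λ i → A i l)) ∙ w
  ∙-assoc c A w = begin
    c ∙ (λ i → A i ∙ w)                        ≡⟨ ∑-cong (λ i → *-∙ (c i) (A i) w) ⟩
    ∑′ (λ i → ∑′ (λ l → c i * A i l * w l))    ≡⟨ ∑-swap (λ i l → c i * A i l * w l) ⟩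
    ∑′ (λ l → ∑′ (λ i → c i * A i l * w l))    ≡⟨ ∑-cong (λ l → ∑-* (w l) (λ i → c i * A i l)) ⟨
    (λ l → c ∙ (λ i → A i l)) ∙ w              ∎

  -- Turns a relation in which `z` has the invertible coefficient `c` into an expression of `z` by
  -- the remaining terms.
  solve-for : ∀ {c y z s} → c * y ≡ 1# → c * z + s ≡ 0# → z ≡ - y * s
  solve-for {c} {y} {z} {s} cy≡1 eq = begin
    z             ≡⟨ trans (cong (_* z) (trans (*-comm y c) cy≡1)) (*-identityˡ z) ⟨
    y * c * z     ≡⟨ *-assoc y c z ⟩
    y * (c * z)   ≡⟨ cong (y *_) (+-inverseˡ-unique (c * z) s eq) ⟩
    y * - s       ≡⟨ -‿distribʳ-* y s ⟨
    - (y * s)     ≡⟨ -‿distribˡ-* y s ⟩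
    - y * s       ∎

  -- Serves for coefficients in `L` and in F_q alike: closure of `S` under differences lets
  -- independence be applied to `c - c′`.
  indep⇒unique : ∀ {S : L → Set} → (∀ {x y} → S x → S y → S (x - y)) →
    ∀ {r n} {w : Fin r → Fin n → L} → LinIndep 𝔽 q S w → ∀ {c c′} → (∀ i → S (c i)) → (∀ i → S (c′ i)) →
    (∀ j → c ∙ (λ i → w i j) ≡ c′ ∙ (λ i → w i j)) → ∀ i → c i ≡ c′ i
  indep⇒unique S-− indep {c} {c′} c∈ c′∈ eq i = x-y≡0⇒x≡y _ _ (indep (λ i → c i - c′ i) (λ i → S-− (c∈ i) (c′∈ i))
    (λ j → trans (∙-− c c′ _) (x≡y⇒x-y≡0 (eq j))) i)

  -- An independent family maps the N ^ r coefficient vectors injectively into the N ^ n vectors of Lⁿ.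
  independent⇒≤ : ∀ {r n} {w : Fin r → Fin n → L} → LinIndep 𝔽 q (All 𝔽 q) w → r ≤ n
  independent⇒≤ {r} {n} {w} indep = ℕ.≮⇒≥ λ n<r →
    let k , l , k<l , eq = pigeonhole (ℕ.^-monoʳ-< N 1<N n<r) (λ k → encode (λ j → decode k ∙ (λ i → w i j)))
    in Fin.<⇒≢ k<l (decode-cong⁻¹ {r} (indep⇒unique _ indep _ _ (encode-cong⁻¹ eq)))

  0*x+y≡y : ∀ {z x y} → z ≡ 0# → z * x + y ≡ y
  0*x+y≡y {x = x} {y} refl = trans (cong (_+ y) (zeroˡ x)) (+-identityˡ y)

  pow-+ : ∀ {p} → Prime p → p · 1# ≡ 0# → ∀ e x y → pow 𝔽 q (x + y) (p ^ e) ≡ pow 𝔽 q x (p ^ e) + pow 𝔽 q y (p ^ e)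
  pow-+ {p} pp p·1≡0 e x y = trans (pow≡^ (x + y) (p ^ e)) (trans ([x+y]^p^e pp p·1≡0 e x y)
    (sym (cong₂ _+_ (pow≡^ x (p ^ e)) (pow≡^ y (p ^ e)))))

  FrobeniusAdditive : Set
  FrobeniusAdditive = ∀ x y → pow 𝔽 q (x + y) q ≡ pow 𝔽 q x q + pow 𝔽 q y q

-- The Frobenius map and its fixed field

module Galois {N : ℕ} (𝔽 : FiniteField N) (q : ℕ) (1<q : 1 < q) (m′ : ℕ) (N≡q^m : N ≡ q ^ suc m′)
  (φ-+ : Field.FrobeniusAdditive 𝔽 q) where

  open FiniteField 𝔽
  open Field 𝔽 q
  open ≡-Reasoning

  private
    m : ℕ
    m = suc m′
    Fq′ All′ : L → Set
    Fq′ = Fq 𝔽 q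
    All′ = All 𝔽 q

  φ : L → L
  φ x = pow 𝔽 q x q

  φ-* : ∀ x y → φ (x * y) ≡ φ x * φ y
  φ-* = pow-* q

  φ-1 : φ 1# ≡ 1#
  φ-1 = pow-1 q

  φ-0 : φ 0# ≡ 0#
  φ-0 = +-identityʳ-unique (φ 0#) (φ 0#) (trans (sym (φ-+ 0# 0#)) (cong φ (+-identityˡ 0#)))

  φ-neg : ∀ x → φ (- x) ≡ - φ x
  φ-neg x = +-inverseˡ-unique (φ (- x)) (φ x)
    (trans (sym (φ-+ (- x) x)) (trans (cong φ (-‿inverseˡ x)) φ-0))

  φ-∙ : ∀ {r} (c w : Fin r → L) → φ (c ∙ w) ≡ (φ ∘ c) ∙ (φ ∘ w)
  φ-∙ c w = trans (∑-hom φ φ-0 φ-+ (λ i → c i * w i)) (∑-cong (λ i → φ-* (c i) (w i)))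

  φ^ : ℕ → L → L
  φ^ zero    x = x
  φ^ (suc t) x = φ (φ^ t x)

  -- The `m`-fold iterate is `x^(q^m) = x^N`. Hence `φ^ m′` inverts `φ` and supplies the preimages
  -- that `descent` asks for.
  φ^m≡id : ∀ x → φ^ m x ≡ x
  φ^m≡id x = trans (φ^≡pow m x) (trans (cong (pow 𝔽 q x) (sym N≡q^m)) (pow-N x))
    where
    φ^≡pow : ∀ t x → φ^ t x ≡ pow 𝔽 q x (q ^ t)
    φ^≡pow zero    x = sym (*-identityʳ x)
    φ^≡pow (suc t) x = trans (cong φ (φ^≡pow t x)) (trans (pow-pow x (q ^ t) q) (cong (pow 𝔽 q x) (ℕ.*-comm (q ^ t) q)))

  Fq-+ : ∀ {x y} → Fq′ x → Fq′ y → Fq′ (x + y)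
  Fq-+ x∈ y∈ = trans (φ-+ _ _) (cong₂ _+_ x∈ y∈)

  Fq-* : ∀ {x y} → Fq′ x → Fq′ y → Fq′ (x * y)
  Fq-* x∈ y∈ = trans (φ-* _ _) (cong₂ _*_ x∈ y∈)

  Fq-neg : ∀ {x} → Fq′ x → Fq′ (- x)
  Fq-neg x∈ = trans (φ-neg _) (cong -_ x∈)

  Fq-inverse : ∀ {x y} → x ≢ 0# → x * y ≡ 1# → Fq′ x → Fq′ y
  Fq-inverse {x} {y} x≢0 xy≡1 x∈ = *-cancelʳ x≢0 (begin
    φ y * x    ≡⟨ cong (φ y *_) x∈ ⟨
    φ y * φ x  ≡⟨ φ-* y x ⟨
    φ (y * x)  ≡⟨ cong φ (trans (*-comm y x) xy≡1) ⟩
    φ 1#       ≡⟨ φ-1 ⟩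
    1#         ≡⟨ trans (*-comm y x) xy≡1 ⟨
    y * x      ∎)

  Fq-∙ : ∀ {r} {c w : Fin r → L} → (∀ i → Fq′ (c i)) → (∀ i → Fq′ (w i)) → Fq′ (c ∙ w)
  Fq-∙ {c = c} {w} c∈ w∈ = trans (φ-∙ c w) (∙-cong c∈ w∈)

  unit : ∀ {n} → Fin n → Fin n → L
  unit zero    zero    = 1#
  unit zero    (suc _) = 0#
  unit (suc _) zero    = 0#
  unit (suc i) (suc j) = unit i j

  unit-Fq : ∀ {n} (i j : Fin n) → Fq′ (unit i j)
  unit-Fq zero    zero    = φ-1
  unit-Fq zero    (suc _) = φ-0
  unit-Fq (suc _) zero    = φ-0
  unit-Fq (suc i) (suc j) = unit-Fq i j

  unit-∙ : ∀ {n} (i : Fin n) (w : Fin n → L) → unit i ∙ w ≡ w i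
  unit-∙ zero    w = trans (cong₂ _+_ (*-identityˡ _) (∑-zero (λ j → zeroˡ (w (suc j))))) (+-identityʳ _)
  unit-∙ (suc i) w = trans (cong₂ _+_ (zeroˡ _) (unit-∙ i (w ∘ suc))) (+-identityˡ _)

  -- Echelon matrices and column bases over F_q

  inSpan-Fq? : ∀ {r n} (w : Fin r → Fin n → L) x → Dec (InSpan 𝔽 q Fq′ w x)
  inSpan-Fq? w x = any-vector?
    (λ { {f} {g} f≗g (f∈ , eq) → (λ i → subst Fq′ (f≗g i) (f∈ i))
                               , λ j → trans (eq j) (∙-cong f≗g (λ _ → refl)) })
    (λ c → all? (λ i → φ (c i) ≟ c i) ×-dec all? (λ j → x j ≟ c ∙ (λ i → w i j)))

  -- `at-pivot` says that the pivot columns form the identity matrix, in the form in which it is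
  -- applied: a combination of the rows shows its coefficients at the pivots.
  record IsEchelon {d n} (pivot : Fin d → Fin n) (A : Fin d → Fin n → L) : Set where
    field
      entry∈Fq : ∀ i j → Fq′ (A i j)
      at-pivot : ∀ (c : Fin d → L) l → c ∙ (λ i → A i (pivot l)) ≡ c l

  -- For `s` vectors of length `n`, `Z j` is the column of their `j`-th entries. The pivot columns
  -- are an F_q-basis of the span of all columns, so this is a rank factorisation over F_q; for
  -- `s = 1`, `rank` is the rank weight and `coord` generates the support.
  record ColumnBasis {n s} (Z : Fin n → Fin s → L) : Set where
    field
      rank      : ℕ
      pivot     : Fin rank → Fin n
      coord     : Fin rank → Fin n → L
      isEchelon : IsEchelon pivot coord
      indep     : LinIndep 𝔽 q Fq′ (Z ∘ pivot)
      expand    : ∀ j t → Z j t ≡ (λ i → coord i j) ∙ (λ i → Z (pivot i) t)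

  -- Columns are treated from the last to the first: each is either expanded in the pivots found so
  -- far or becomes a new pivot.
  columnBasis : ∀ {n s} (Z : Fin n → Fin s → L) → ColumnBasis Z
  columnBasis {zero} Z = record
    { rank = 0 ; pivot = λ () ; coord = λ () ; isEchelon = record { entry∈Fq = λ () ; at-pivot = λ c () }
    ; indep = λ c c∈ eq () ; expand = λ () }
  columnBasis {suc n} {s} Z with columnBasis (Z ∘ suc)
  ... | CB with inSpan-Fq? (Z ∘ suc ∘ ColumnBasis.pivot CB) (Z zero)
  ...   | yes (c , c∈ , eq) = record
    { rank = rank
    ; pivot = suc ∘ pivot
    ; coord = λ i → λ { zero → c i ; (suc j) → coord i j }
    ; isEchelon = record { entry∈Fq = λ i → λ { zero → c∈ i ; (suc j) → entry∈Fq i j } ; at-pivot = at-pivot }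
    ; indep = indep
    ; expand = λ { zero t → eq t ; (suc j) t → expand j t } }
    where
    open ColumnBasis CB
    open IsEchelon isEchelon
  ...   | no ∉span = record
    { rank = suc rank
    ; pivot = λ { zero → zero ; (suc i) → suc (pivot i) }
    ; coord = λ { zero → unit zero ; (suc i) → λ { zero → 0# ; (suc j) → coord i j } }
    ; isEchelon = record
      { entry∈Fq = λ { zero → unit-Fq zero ; (suc i) → λ { zero → φ-0 ; (suc j) → entry∈Fq i j } }
      ; at-pivot = λ { c zero → trans (cong₂ _+_ (*-identityʳ _) (∑-zero (λ i → zeroʳ (c (suc i))))) (+-identityʳ _)
                     ; c (suc l) → trans (cong₂ _+_ (zeroʳ _) (at-pivot (c ∘ suc) l)) (+-identityˡ _) } }
    ; indep = indep′
    ; expand = λ { zero t → sym (unit-∙ zero (Z′ t))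
                 ; (suc j) t → trans (expand j t) (sym (0*x+y≡y refl)) } }
    where
    open ColumnBasis CB
    open IsEchelon isEchelon
    Z′ : Fin s → Fin (suc rank) → L
    Z′ t zero    = Z zero t
    Z′ t (suc i) = Z (suc (pivot i)) t
    indep′ : ∀ c → (∀ i → Fq′ (c i)) → (∀ t → c zero * Z zero t + (c ∘ suc) ∙ (λ i → Z (suc (pivot i)) t) ≡ 0#) →
             ∀ i → c i ≡ 0#
    indep′ c c∈ eq with c zero ≟ 0#
    ... | yes c₀≡0 = λ { zero → c₀≡0 ; (suc i) → indep (c ∘ suc) (c∈ ∘ suc) (λ t →
            trans (sym (0*x+y≡y c₀≡0)) (eq t)) i }
    -- A nonzero coefficient of the new column is invertible in F_q, which would put that column in
    -- the F_q-span of the old pivots.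
    ... | no c₀≢0 with inverse (c zero) c₀≢0
    ...   | y , c₀y≡1 = contradiction ((λ i → - y * c (suc i))
            , (λ i → Fq-* (Fq-neg (Fq-inverse c₀≢0 c₀y≡1 (c∈ zero))) (c∈ (suc i)))
            , λ t → trans (solve-for c₀y≡1 (eq t)) (*-∙ (- y) (c ∘ suc) _)) ∉span

  -- Galois descent and rank bounds

  -- Normalise t to t₀ = 1; then t − φ t is a relation with one term fewer, so it vanishes and t is defined over F_q.
  descent : ∀ {d} (V : (Fin d → L) → Set) →
    (∀ v → V v → ∃ λ v′ → V v′ × (∀ i → v i ≡ φ (v′ i))) →
    (∀ c → (∀ i → Fq′ (c i)) → (∀ v → V v → c ∙ v ≡ 0#) → ∀ i → c i ≡ 0#) →
    ∀ t → (∀ v → V v → t ∙ v ≡ 0#) → ∀ i → t i ≡ 0#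
  descent {suc d} V φ-surj Fq-indep t t∙V≡0 = result
    where
    tail-indep : ∀ s → (∀ v → V v → s ∙ (v ∘ suc) ≡ 0#) → ∀ i → s i ≡ 0#
    -- The induction runs on `V` with the first coordinate deleted; an F_q-relation there is padded
    -- with a leading 0.
    tail-indep s s∙V≡0 = descent (λ u → ∃ λ v → V v × (∀ i → u i ≡ v (suc i)))
      (λ { u (v , Vv , u≗v) → let v′ , Vv′ , eq = φ-surj v Vv in
             v′ ∘ suc , (v′ , Vv′ , λ _ → refl) , λ i → trans (u≗v i) (eq (suc i)) })
      (λ c c∈ c∙≡0 i → Fq-indep (λ { zero → 0# ; (suc j) → c j }) (λ { zero → φ-0 ; (suc j) → c∈ j })
        (λ v Vv → trans (0*x+y≡y refl) (c∙≡0 (v ∘ suc) (v , Vv , λ _ → refl))) (suc i))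
      s (λ { u (v , Vv , u≗v) → trans (∙-cong (λ _ → refl) u≗v) (s∙V≡0 v Vv) })
    result : ∀ i → t i ≡ 0#
    result with t zero ≟ 0#
    ... | yes t₀≡0 = λ { zero → t₀≡0 ; (suc i) → tail-indep (t ∘ suc) (λ v Vv →
            trans (sym (0*x+y≡y t₀≡0)) (t∙V≡0 v Vv)) i }
    ... | no t₀≢0 with inverse (t zero) t₀≢0
    ...   | y , t₀y≡1 = contradiction (trans (sym (Fq-indep s s∈Fq s∙V≡0 zero)) s₀≡1) 0≢1
      where
      s : Fin (suc d) → L
      s i = y * t i
      s₀≡1 : s zero ≡ 1#
      s₀≡1 = trans (*-comm y (t zero)) t₀y≡1
      s∙V≡0 : ∀ v → V v → s ∙ v ≡ 0#
      s∙V≡0 v Vv = trans (sym (*-∙ y t v)) (trans (cong (y *_) (t∙V≡0 v Vv)) (zeroʳ y))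
      φs∙V≡0 : ∀ v → V v → (φ ∘ s) ∙ v ≡ 0#
      -- Applying φ to the relation at `v′` gives a relation at `v = φ v′`; this is where preimages
      -- inside `V` enter.
      φs∙V≡0 v Vv with φ-surj v Vv
      ... | v′ , Vv′ , v≗φv′ = begin
        (φ ∘ s) ∙ v         ≡⟨ ∙-cong {c = φ ∘ s} (λ _ → refl) v≗φv′ ⟩
        (φ ∘ s) ∙ (φ ∘ v′)  ≡⟨ φ-∙ s v′ ⟨
        φ (s ∙ v′)          ≡⟨ cong φ (s∙V≡0 v′ Vv′) ⟩
        φ 0#                ≡⟨ φ-0 ⟩
        0#                  ∎
      s-φs : Fin (suc d) → L
      s-φs i = s i - φ (s i)
      s-φs₀≡0 : s-φs zero ≡ 0#
      s-φs₀≡0 = x≡y⇒x-y≡0 (trans s₀≡1 (sym (trans (cong φ s₀≡1) φ-1)))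
      tail∙V≡0 : ∀ v → V v → (s-φs ∘ suc) ∙ (v ∘ suc) ≡ 0#
      tail∙V≡0 v Vv = begin
        (s-φs ∘ suc) ∙ (v ∘ suc)                        ≡⟨ 0*x+y≡y s-φs₀≡0 ⟨
        s-φs ∙ v                                        ≡⟨ ∙-− s (φ ∘ s) v ⟩
        s ∙ v - (φ ∘ s) ∙ v                             ≡⟨ x≡y⇒x-y≡0 (trans (s∙V≡0 v Vv) (sym (φs∙V≡0 v Vv))) ⟩
        0#                                              ∎
      s∈Fq : ∀ i → Fq′ (s i)
      s∈Fq zero    = trans (cong φ s₀≡1) (trans φ-1 (sym s₀≡1))
      s∈Fq (suc i) = sym (x-y≡0⇒x≡y _ _ (tail-indep (s-φs ∘ suc) tail∙V≡0 i))

  -- By descent the columns (φᵗ cᵢ)_{t<m} of the Moore matrix are L-independent; φᵐ = id closes V under preimages.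
  Fq-indep⇒≤m : ∀ {r} (c : Fin r → L) → LinIndep 𝔽 q Fq′ {r} {1} (λ i _ → c i) → r ≤ m
  Fq-indep⇒≤m c c-indep = independent⇒≤ {w = λ i (t : Fin m) → φ^ (toℕ t) (c i)} λ s _ eq →
    descent (λ v → ∃ λ (t : Fin m) → ∀ i → v i ≡ φ^ (toℕ t) (c i))
      (λ { v (zero , v≗) → (λ i → φ^ (toℕ (fromℕ m′)) (c i)) , (fromℕ m′ , λ _ → refl)
                         , λ i → trans (v≗ i) (sym (trans (cong (λ k → φ (φ^ k (c i))) (toℕ-fromℕ m′)) (φ^m≡id (c i))))
         ; v (suc t , v≗) → (λ i → φ^ (toℕ t) (c i)) , (inject₁ t , λ i → cong (λ k → φ^ k (c i)) (sym (toℕ-inject₁ t))) , v≗ })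
      (λ b b∈ b∙≡0 → c-indep b b∈ (λ _ → b∙≡0 c (zero , λ _ → refl)))
      s (λ { v (t , v≗) → trans (∙-cong (λ _ → refl) v≗) (eq t) })

  -- An `L`-relation between the columns of `B` at `π` annihilates the span of `B` restricted to
  -- `π`. This set is closed under preimages of φ and contains the restrictions of the given
  -- vectors, which admit no F_q-relation, so by descent the `r` columns are independent in `L^d`.
  galois-rank : ∀ {d n r s} (B : Fin d → Fin n → L) → GaloisClosedBasis 𝔽 q B →
    (Z : Fin n → Fin s → L) → (∀ t → InSpan 𝔽 q All′ B (λ j → Z j t)) →
    (π : Fin r → Fin n) → LinIndep 𝔽 q Fq′ (Z ∘ π) → r ≤ d
  galois-rank B (_ , closed) Z Z∈B π Z-indep = independent⇒≤ {w = λ i l → B l (π i)} λ s _ eq →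
    descent (λ v → ∃ λ b → InSpan 𝔽 q All′ B b × (∀ i → v i ≡ b (π i)))
      -- The preimage under φ is `φ^ m′`, which stays in the span of `B` by iterating its Galois
      -- closedness.
      (λ { v (b , b∈ , v≗) → (λ i → φ^ m′ (b (π i))) , ((λ j → φ^ m′ (b j)) , closed^ m′ b b∈ , λ _ → refl)
                            , λ i → trans (v≗ i) (sym (φ^m≡id (b (π i)))) })
      (λ c c∈ c∙≡0 → Z-indep c c∈ (λ t → c∙≡0 (λ i → Z (π i) t) ((λ j → Z j t) , Z∈B t , λ _ → refl)))
      s (λ { v (b , (c , _ , b≡) , v≗) → begin
        s ∙ v                                     ≡⟨ ∙-cong (λ _ → refl) (λ i → trans (v≗ i) (b≡ (π i))) ⟩
        s ∙ (λ i → c ∙ (λ l → B l (π i)))         ≡⟨ ∙-cong {c = s} (λ _ → refl) (λ i → ∙-comm c (λ l → B l (π i))) ⟩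
        s ∙ (λ i → (λ l → B l (π i)) ∙ c)         ≡⟨ ∙-assoc s (λ i l → B l (π i)) c ⟩
        (λ l → s ∙ (λ i → B l (π i))) ∙ c         ≡⟨ ∑-zero (λ l → trans (cong (_* c l) (eq l)) (zeroˡ _)) ⟩
        0#                                        ∎ })
    where
    closed^ : ∀ t b → InSpan 𝔽 q All′ B b → InSpan 𝔽 q All′ B (λ j → φ^ t (b j))
    closed^ zero    b b∈ = b∈
    closed^ (suc t) b b∈ = closed (λ j → φ^ t (b j)) (closed^ t b b∈)

  -- Galois closed spaces and rank supports

  module _ {d n} {π : Fin d → Fin n} {A : Fin d → Fin n → L} (echelon : IsEchelon π A) where
    open IsEchelon echelon

    -- The entries of `A` are fixed by φ, so Frobenius only changes the coefficients of a
    -- combination; independence is read off at the pivots.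
    echelon-galoisClosed : GaloisClosedBasis 𝔽 q A
    echelon-galoisClosed =
        (λ c _ eq l → trans (sym (at-pivot c l)) (eq (π l)))
      , λ { x (c , _ , x≡) → φ ∘ c , _ , λ j → trans (cong φ (x≡ j))
              (trans (φ-∙ c (λ i → A i j)) (∙-cong {c = φ ∘ c} (λ _ → refl) (λ i → entry∈Fq i j))) }

    span-at-pivot : ∀ {x} → InSpan 𝔽 q All′ A x → ∀ j → x j ≡ (x ∘ π) ∙ (λ i → A i j)
    span-at-pivot (c , _ , x≡) j = trans (x≡ j) (∙-cong (λ i → sym (trans (x≡ (π i)) (at-pivot c i))) (λ _ → refl))

    -- In any factorisation `x = u A′`, replacing each row of `A′` by the combination of `A` with
    -- the same pivot entries gives `x` again. As `u` is F_q-independent, the rows agree, so they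
    -- lie in the F_q-row space of `A`.
    supp⊆span : ∀ {x z} → InSpan 𝔽 q All′ A x → InSupp 𝔽 q x z → InSpan 𝔽 q Fq′ A z
    supp⊆span {x} {z} x∈ (r , u , A′ , u-indep , _ , A′∈ , x≡ , (b , b∈ , z≡)) =
        (λ i → b ∙ (λ l → A′ l (π i)))
      , (λ i → Fq-∙ b∈ (λ l → A′∈ l (π i)))
      , λ j → begin
          z j                                            ≡⟨ z≡ j ⟩
          b ∙ (λ l → A′ l j)                             ≡⟨ ∙-cong {c = b} (λ _ → refl) (A′-at-pivot j) ⟩
          b ∙ (λ l → (A′ l ∘ π) ∙ (λ i → A i j))         ≡⟨ ∙-assoc b (λ l → A′ l ∘ π) (λ i → A i j) ⟩
          (λ i → b ∙ (λ l → A′ l (π i))) ∙ (λ i → A i j) ∎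
      where
      A′-at-pivot : ∀ j l → A′ l j ≡ (A′ l ∘ π) ∙ (λ i → A i j)
      A′-at-pivot j = indep⇒unique {S = Fq′} (λ a∈ b∈ → Fq-+ a∈ (Fq-neg b∈)) u-indep
        (λ l → A′∈ l j) (λ l → Fq-∙ (λ i → A′∈ l (π i)) (λ i → entry∈Fq i j)) λ _ → begin
          (λ l → A′ l j) ∙ u                             ≡⟨ ∙-comm (λ l → A′ l j) u ⟩
          u ∙ (λ l → A′ l j)                             ≡⟨ x≡ j ⟨
          x j                                            ≡⟨ span-at-pivot x∈ j ⟩
          (x ∘ π) ∙ (λ i → A i j)                        ≡⟨ ∙-cong (λ i → x≡ (π i)) (λ _ → refl) ⟩
          (λ i → u ∙ (λ l → A′ l (π i))) ∙ (λ i → A i j) ≡⟨ ∙-assoc u (λ l → A′ l ∘ π) (λ i → A i j) ⟨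
          u ∙ (λ l → (A′ l ∘ π) ∙ (λ i → A i j))         ≡⟨ ∙-comm u (λ l → (A′ l ∘ π) ∙ (λ i → A i j)) ⟩
          (λ l → (A′ l ∘ π) ∙ (λ i → A i j)) ∙ u         ∎

    -- Independence of the pivot entries makes `x = (x ∘ π) A` itself a factorisation of the kind
    -- that defines the support.
    span⊆supp : ∀ {x z} → LinIndep 𝔽 q Fq′ {d} {1} (λ i _ → x (π i)) →
                InSpan 𝔽 q All′ A x → InSpan 𝔽 q Fq′ A z → InSupp 𝔽 q x z
    span⊆supp {x} x∘π-indep x∈ z∈ =
      d , x ∘ π , A , x∘π-indep , (λ i → unit (π i) , unit-Fq (π i) , λ _ → sym (unit-∙ (π i) x))
        , entry∈Fq , span-at-pivot x∈ , z∈

    -- The support of `u` lies in the F_q-row space of `A`, and that of `x` is the whole of it.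
    suppSub : ∀ {x u} → LinIndep 𝔽 q Fq′ {d} {1} (λ i _ → x (π i)) →
              InSpan 𝔽 q All′ A x → InSpan 𝔽 q All′ A u → SuppSub 𝔽 q u x
    suppSub x∘π-indep x∈ u∈ z z∈supp = span⊆supp x∘π-indep x∈ (supp⊆span u∈ z∈supp)

  -- Combinations of full rank weight

  Fq-relation : ∀ {d} → (Fin d → L) → (Fin d → L) → Set
  Fq-relation w c = (∀ i → Fq′ (c i)) × (∃ λ i → c i ≢ 0#) × c ∙ w ≡ 0#

  Fq-relation? : ∀ {d} (w : Fin d → L) → Dec (∃ (Fq-relation w))
  Fq-relation? w = any-vector?
    (λ { {f} {g} f≗g (f∈ , (i , fi≢0) , f∙w≡0) →
           (λ j → subst Fq′ (f≗g j) (f∈ j)) , (i , fi≢0 ∘ trans (f≗g i))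
         , trans (∙-cong (λ j → sym (f≗g j)) (λ _ → refl)) f∙w≡0 })
    (λ c → all? (λ i → φ (c i) ≟ c i) ×-dec any? (λ i → ¬? (c i ≟ 0#)) ×-dec (c ∙ w ≟ 0#))

  Fq-enumeration : Enumeration (Fq′ ∘ fromIndex)
  Fq-enumeration = enumerate (λ k → φ (fromIndex k) ≟ fromIndex k)

  -- By `Fq-size` there are at most `q ^ d` vectors over F_q, coded through the enumeration of F_q.
  Fq-vector-pigeonhole : ∀ {d s} → q ^ d < s → (c : Fin s → Fin d → L) → (∀ k i → Fq′ (c k i)) →
                         ∃ λ k → ∃ λ l → k Fin.< l × (∀ i → c k i ≡ c l i)
  Fq-vector-pigeonhole {d} {s} q^d<s c c∈ =
    let k , l , k<l , eq = pigeonhole (ℕ.≤-<-trans (ℕ.^-monoˡ-≤ d size≤q) q^d<s) (funToFin ∘ code)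
    in k , l , k<l , λ i → trans (sym (decoded k i)) (trans (cong (λ z → fromIndex (E.elem (finToFun z i))) eq) (decoded l i))
    where
    module E = Enumeration Fq-enumeration
    size≤q : E.size ≤ q
    size≤q = Fq-size 1<q (fromIndex ∘ E.elem) (E.elem-inj ∘ Injection.injective (↔⇒↣ card)) E.sound
    code : Fin s → Fin d → Fin E.size
    code k i = E.index (toIndex (c k i)) (subst Fq′ (sym (fromIndex∘toIndex (c k i))) (c∈ k i))
    decoded : ∀ k i → fromIndex (E.elem (finToFun (funToFin (code k)) i)) ≡ c k i
    decoded k i = trans (cong (fromIndex ∘ E.elem) (finToFun-funToFin (code k) i))
      (trans (cong fromIndex (E.elem-index _ _)) (fromIndex∘toIndex (c k i)))

  -- If every β ∈ L admitted a relation, two of the q^m + 1 > q^d vectors formed by these relations and 0 would agree.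
  generic-combination : ∀ {d} (a b : Fin d → L) → d ≤ m →
    (∀ c → (∀ i → Fq′ (c i)) → c ∙ a ≡ 0# → c ∙ b ≡ 0# → ∀ i → c i ≡ 0#) →
    ∃ λ β → LinIndep 𝔽 q Fq′ {d} {1} (λ i _ → a i + β * b i)
  generic-combination {d} a b d≤m ab-indep with any-scalar? (λ β → ¬? (Fq-relation? (λ i → a i + β * b i)))
  ... | yes (β , none) = β , λ c c∈ eq i → decidable-stable (c i ≟ 0#) λ ci≢0 →
          none (c , c∈ , (i , ci≢0) , eq zero)
  ... | no all-related = collision (Fq-vector-pigeonhole q^d<1+N vec vec∈Fq)
    where
    relation : ∀ β → ∃ (Fq-relation (λ i → a i + β * b i))
    relation β = decidable-stable (Fq-relation? (λ i → a i + β * b i)) (λ none → all-related (β , none))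
    vec : Fin (suc N) → Fin d → L
    vec zero    = λ _ → 0#
    vec (suc k) = proj₁ (relation (fromIndex k))
    vec∈Fq : ∀ k i → Fq′ (vec k i)
    vec∈Fq zero    i = φ-0
    vec∈Fq (suc k) i = proj₁ (proj₂ (relation (fromIndex k))) i
    q^d<1+N : q ^ d < suc N
    -- The zero vector added to the `N` relations makes the inequality strict even for `d = m`.
    q^d<1+N = s≤s (subst (q ^ d ≤_) (sym N≡q^m) (ℕ.^-monoʳ-≤ q {{ℕ.>-nonZero (ℕ.<-trans (s≤s z≤n) 1<q)}} d≤m))
    expand : ∀ c β → c ∙ (λ i → a i + β * b i) ≡ c ∙ a + β * c ∙ b
    expand c β = begin
      c ∙ (λ i → a i + β * b i)           ≡⟨ ∙-comm c (λ i → a i + β * b i) ⟩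
      (λ i → a i + β * b i) ∙ c           ≡⟨ ∙-+ a (λ i → β * b i) c ⟩
      a ∙ c + (λ i → β * b i) ∙ c         ≡⟨ cong (a ∙ c +_) (*-∙ β b c) ⟨
      a ∙ c + β * b ∙ c                   ≡⟨ cong₂ (λ y z → y + β * z) (∙-comm a c) (∙-comm b c) ⟩
      c ∙ a + β * c ∙ b                   ∎
    collision : (∃ λ k → ∃ λ l → k Fin.< l × (∀ i → vec k i ≡ vec l i)) → _
    -- The zero vector differs from every relation, since relations are nontrivial.
    collision (zero , suc l , _ , eq) =
      let i , ci≢0 = proj₁ (proj₂ (proj₂ (relation (fromIndex l)))) in contradiction (sym (eq i)) ci≢0
    collision (suc k , suc l , s≤s k<l , eq) = contradiction
      (Injection.injective (↔⇒↣ card) (decidable-stable (β ≟ β′) β≢β′→⊥)) (Fin.<⇒≢ k<l)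
      where
      β β′ : L
      β  = fromIndex k
      β′ = fromIndex l
      c : Fin d → L
      c = vec (suc k)
      eq₁ : c ∙ a + β * c ∙ b ≡ 0#
      eq₁ = trans (sym (expand c β)) (proj₂ (proj₂ (proj₂ (relation β))))
      eq₂ : c ∙ a + β′ * c ∙ b ≡ 0#
      eq₂ = trans (sym (expand c β′)) (trans (∙-cong eq (λ _ → refl)) (proj₂ (proj₂ (proj₂ (relation β′)))))
      -- A common relation `c` has `c ∙ a + β * c ∙ b` and `c ∙ a + β′ * c ∙ b` both zero. Either
      -- `c ∙ b` is nonzero and `β = β′`, or `c` annihilates `a` and `b`, against `ab-indep`.
      β≢β′→⊥ : ¬ β ≢ β′
      β≢β′→⊥ β≢β′ with c ∙ b ≟ 0#
      ... | no c∙b≢0 = β≢β′ (*-cancelʳ c∙b≢0 (+-cancelˡ (c ∙ a) _ _ (trans eq₁ (sym eq₂))))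
      ... | yes c∙b≡0 with proj₁ (proj₂ (proj₂ (relation β)))
      ...   | i , ci≢0 = ci≢0 (ab-indep c (vec∈Fq (suc k)) (begin
        c ∙ a                ≡⟨ +-identityʳ (c ∙ a) ⟨
        c ∙ a + 0#           ≡⟨ cong (c ∙ a +_) (trans (cong (β *_) c∙b≡0) (zeroʳ β)) ⟨
        c ∙ a + β * c ∙ b    ≡⟨ eq₁ ⟩
        0#                   ∎) c∙b≡0 i)

  -- The two implications

  pair : ∀ {a} {X : Set a} → X → X → Fin 2 → X
  pair x y zero    = x
  pair x y (suc _) = y

  minimal⇒m<d₂ : ∀ {k n} (G : Fin k → Fin n → L) → IsMinimalCode 𝔽 q G →
                 ∀ {d₂} → IsGenRankWeight 𝔽 q G 2 d₂ → m < d₂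
  minimal⇒m<d₂ {n = n} G minimal {d₂} ((B , closed , W , W-indep , W∈) , _) = ℕ.≰⇒> λ d₂≤m →
    contradict (generic-combination (x ∘ pivot) (y ∘ pivot)
      -- The columns of `W` have F_q-rank at most `d₂`, as both codewords lie in the Galois closed
      -- span of `B`.
      (ℕ.≤-trans (galois-rank B closed (λ j t → W t j) (λ t → proj₁ (W∈ t)) pivot indep) d₂≤m)
      (λ c c∈ c∙x≡0 c∙y≡0 → indep c c∈ λ { zero → c∙x≡0 ; (suc zero) → c∙y≡0 }))
    where
    open ColumnBasis (columnBasis (λ j t → W t j))
    x y : Fin n → L
    x = W zero
    y = W (suc zero)
    contradict : (∃ λ β → LinIndep 𝔽 q Fq′ {rank} {1} (λ i _ → x (pivot i) + β * y (pivot i))) → ⊥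
    -- Minimality gives `y = μ (x + β y)`; comparing coefficients of the independent `x` and `y`
    -- yields `0 = μ` and `1 = μ β`.
    contradict (β , v∘π-indep) = 0≢1 (begin
      0#        ≡⟨ zeroˡ β ⟨
      0# * β    ≡⟨ cong (_* β) (coefficients zero) ⟩
      μ * β     ≡⟨ coefficients (suc zero) ⟨
      1#        ∎)
      where
      v : Fin n → L
      v j = x j + β * y j
      combine-spans : ∀ {r} {w : Fin r → Fin n → L} → InSpan 𝔽 q All′ w x → InSpan 𝔽 q All′ w y → InSpan 𝔽 q All′ w v
      combine-spans {w = w} (c , _ , x≡) (c′ , _ , y≡) = (λ i → c i + β * c′ i) , _ , λ j → begin
        x j + β * y j                                     ≡⟨ cong₂ (λ a b → a + β * b) (x≡ j) (y≡ j) ⟩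
        c ∙ (λ i → w i j) + β * c′ ∙ (λ i → w i j)        ≡⟨ cong (c ∙ (λ i → w i j) +_) (*-∙ β c′ (λ i → w i j)) ⟩
        c ∙ (λ i → w i j) + (λ i → β * c′ i) ∙ (λ i → w i j) ≡⟨ ∙-+ c (λ i → β * c′ i) (λ i → w i j) ⟨
        (λ i → c i + β * c′ i) ∙ (λ i → w i j)            ∎
      W∈coord : ∀ t → InSpan 𝔽 q All′ coord (W t)
      W∈coord t = W t ∘ pivot , _ , λ j → trans (expand j t) (∙-comm (λ i → coord i j) (W t ∘ pivot))
      v≢0 : ¬ (∀ j → v j ≡ 0#)
      v≢0 v≡0 = 0≢1 (sym (W-indep (pair 1# β) _ (λ j →
        trans (cong₂ _+_ (*-identityˡ (x j)) (+-identityʳ (β * y j))) (v≡0 j)) zero))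
      y-multiple : Σ L λ μ → ∀ j → y j ≡ μ * v j
      y-multiple = Equivalence.to
        (proj₂ (minimal v (combine-spans (proj₂ (W∈ zero)) (proj₂ (W∈ (suc zero)))) v≢0) y (proj₂ (W∈ (suc zero))))
        -- Both `v` and `y` lie in the span of `coord`, and the choice of `β` makes the support of
        -- `v` its full F_q-row space.
        (suppSub isEchelon v∘π-indep (combine-spans (W∈coord zero) (W∈coord (suc zero))) (W∈coord (suc zero)))
      μ : L
      μ = proj₁ y-multiple
      coefficients : ∀ i → pair 0# 1# i ≡ pair μ (μ * β) i
      coefficients = indep⇒unique _ {w = W} W-indep _ _ λ j → begin
        0# * x j + (1# * y j + 0#)      ≡⟨ 0*x+y≡y refl ⟩
        1# * y j + 0#                   ≡⟨ trans (+-identityʳ _) (*-identityˡ (y j)) ⟩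
        y j                             ≡⟨ proj₂ y-multiple j ⟩
        μ * (x j + β * y j)             ≡⟨ distribˡ μ (x j) (β * y j) ⟩
        μ * x j + μ * (β * y j)         ≡⟨ cong (μ * x j +_) (trans (sym (*-assoc μ β (y j))) (sym (+-identityʳ _))) ⟩
        μ * x j + (μ * β * y j + 0#)    ∎

  -- A nonzero coefficient of `u` would make `u` a multiple of `v`; once it is zero, the coefficient
  -- of `v` vanishes because `v` does not.
  pair-indep : ∀ {n} {v u : Fin n → L} → ¬ (∀ j → v j ≡ 0#) → ¬ (Σ L λ μ → ∀ j → u j ≡ μ * v j) →
               LinIndep 𝔽 q All′ (pair v u)
  pair-indep {v = v} {u} v≢0 u∦v c _ eq with c (suc zero) ≟ 0#
  ... | yes c₁≡0 = λ { zero → c₀≡0 ; (suc zero) → c₁≡0 }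
    where
    c₀≡0 : c zero ≡ 0#
    c₀≡0 = decidable-stable (c zero ≟ 0#) λ c₀≢0 → v≢0 λ j → x*y≡0⇒y≡0 c₀≢0 (begin
      c zero * v j                              ≡⟨ +-identityʳ _ ⟨
      c zero * v j + 0#                         ≡⟨ cong (c zero * v j +_) (0*x+y≡y {x = u j} c₁≡0) ⟨
      c zero * v j + (c (suc zero) * u j + 0#)  ≡⟨ eq j ⟩
      0#                                        ∎)
  ... | no c₁≢0 with inverse (c (suc zero)) c₁≢0
  ...   | y , c₁y≡1 = contradiction (- y * c zero , λ j → trans (solve-for c₁y≡1 (begin
      c (suc zero) * u j + c zero * v j         ≡⟨ +-comm _ _ ⟩
      c zero * v j + c (suc zero) * u j         ≡⟨ cong (c zero * v j +_) (+-identityʳ _) ⟨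
      c zero * v j + (c (suc zero) * u j + 0#)  ≡⟨ eq j ⟩
      0#                                        ∎)) (sym (*-assoc (- y) (c zero) (v j)))) u∦v

  m<d₂⇒minimal : ∀ {k n} (G : Fin k → Fin n → L) → ∀ {d₂} → IsGenRankWeight 𝔽 q G 2 d₂ →
                 m < d₂ → IsMinimalCode 𝔽 q G
  m<d₂⇒minimal {n = n} G {d₂} (_ , d₂-least) m<d₂ v v∈C v≢0 = v≢0 , λ u u∈C →
    -- If `u` were not a multiple of `v`, two independent codewords would lie in the Galois closed
    -- span of `coord`, giving `d₂ ≤ rank ≤ m`. Proportionality is decidable, so the contradiction
    -- suffices.
    mk⇔ (λ sub → decidable-stable (multiple? u) λ u∦v → ℕ.<⇒≱ m<d₂ (ℕ.≤-trans
          (d₂-least rank coord (echelon-galoisClosed isEchelon) (pair v u , pair-indep v≢0 u∦v ,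
            λ { zero → v∈coord , v∈C ; (suc zero) → sub⇒∈coord u sub , u∈C }))
          (Fq-indep⇒≤m (v ∘ pivot) indep)))
        -- A multiple of `v` stays in the span of `coord`, whose F_q-row space is the support of
        -- `v`.
        (λ { (μ , u≡μv) → suppSub isEchelon indep v∈coord ((λ i → μ * v (pivot i)) , _ , λ j →
          trans (u≡μv j) (trans (cong (μ *_) (proj₂ (proj₂ v∈coord) j)) (*-∙ μ (v ∘ pivot) (λ i → coord i j)))) })
    where
    open ColumnBasis (columnBasis {s = 1} (λ j _ → v j))
    v∈coord : InSpan 𝔽 q All′ coord v
    v∈coord = v ∘ pivot , _ , λ j → trans (expand j zero) (∙-comm (λ i → coord i j) (v ∘ pivot))
    multiple? : ∀ u → Dec (Σ L λ μ → ∀ j → u j ≡ μ * v j)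
    multiple? u = any-scalar? (λ μ → all? (λ j → u j ≟ μ * v j))
    -- The rows of the echelon matrix of `u` belong to the support of `u`, hence to that of `v`,
    -- hence to the F_q-span of `coord`; and `u` is an `L`-combination of these rows.
    sub⇒∈coord : ∀ u → SuppSub 𝔽 q u v → InSpan 𝔽 q All′ coord u
    sub⇒∈coord u sub = (λ l → (u ∘ U.pivot) ∙ (λ i → proj₁ (row i) l)) , _ , λ j → begin
      u j                                                         ≡⟨ proj₂ (proj₂ u∈coord) j ⟩
      (u ∘ U.pivot) ∙ (λ i → U.coord i j)                         ≡⟨ ∙-cong {c = u ∘ U.pivot} (λ _ → refl) (λ i → proj₂ (proj₂ (row i)) j) ⟩
      (u ∘ U.pivot) ∙ (λ i → proj₁ (row i) ∙ (λ l → coord l j))   ≡⟨ ∙-assoc (u ∘ U.pivot) (λ i → proj₁ (row i)) (λ l → coord l j) ⟩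
      (λ l → (u ∘ U.pivot) ∙ (λ i → proj₁ (row i) l)) ∙ (λ l → coord l j) ∎
      where
      module U = ColumnBasis (columnBasis {s = 1} (λ j _ → u j))
      u∈coord : InSpan 𝔽 q All′ U.coord u
      u∈coord = u ∘ U.pivot , _ , λ j → trans (U.expand j zero) (∙-comm (λ i → U.coord i j) (u ∘ U.pivot))
      row : ∀ i → InSpan 𝔽 q Fq′ coord (U.coord i)
      row i = supp⊆span isEchelon v∈coord (sub (U.coord i) (span⊆supp U.isEchelon U.indep u∈coord
        (unit i , unit-Fq i , λ j → sym (unit-∙ i (λ l → U.coord l j)))))

-- Specialisation to a prime power q = p^e

theorem3p4 : (q n m k : ℕ) → IsPrimePower q → 1 ≤ n → 1 ≤ m → 2 ≤ k →
    (𝔽 : FiniteField (q ^ m)) →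
    (G : Fin k → Fin n → FiniteField.L 𝔽) → LinIndep 𝔽 q (All 𝔽 q) G →
    Nondegenerate 𝔽 q G →
    (d₂ : ℕ) → IsGenRankWeight 𝔽 q G 2 d₂ →
    (IsMinimalCode 𝔽 q G ⇔ (suc m ≤ d₂))
theorem3p4 q n m@(suc m′) k (p , e , p-prime , 1≤e , refl) _ _ _ 𝔽 G _ _ d₂ d₂-weight =
  mk⇔ (λ minimal → minimal⇒m<d₂ G minimal d₂-weight) (m<d₂⇒minimal G d₂-weight)
  where
  open FiniteField 𝔽
  open Field 𝔽 q
  1<q : 1 < q
  1<q = ℕ.^-monoʳ-< p (ℕ.nonTrivial⇒n>1 p {{prime⇒nonTrivial p-prime}}) 1≤e
  p·1≡0 : p · 1# ≡ 0#
  -- `L` has `(p ^ e) ^ m = p ^ (e * m)` elements, so its characteristic is `p`.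
  p·1≡0 = p^k·1≡0⇒p·1≡0 p (e ℕ.* m) (subst (λ N → N · 1# ≡ 0#) (ℕ.^-*-assoc p e m) N·1≡0)
  φ-+ : FrobeniusAdditive
  φ-+ = pow-+ p-prime p·1≡0 e
  open Galois 𝔽 q 1<q m′ refl φ-+
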